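{- Let $\kappa<\lambda$ be uncountable cardinals with $\lambda$ regular, and suppose there is a full $\square(\lambda,<\kappa)$-sequence. Then $\mathrm{Refl}(<\kappa,S)$ fails for every stationary $S\subseteq\lambda$.
   Context: For a set of ordinals $A$, $\mathrm{acc}(A)$ is the set of $\beta<\sup\{\alpha+1\mid\alpha\in A\}$ with $\beta=\sup(A\cap\beta)$. A coherent sequence of length $\lambda$ and width $<\eta$ is $\mathcal{C}=\langle\mathcal{C}_\alpha\mid\alpha<\lambda\rangle$ where each $\mathcal{C}_\alpha$ is a nonempty set of fewer than $\eta$ closed unbounded subsets of $\alpha$ (for successor $\alpha=\beta+1$, $\mathcal{C}_\alpha=\{\{\beta\}\}$), such that for all $\beta<\lambda$, $C\in\mathcal{C}_\beta$ and $\alpha\in\mathrm{acc}(C)$, $C\cap\alpha\in\mathcal{C}_\alpha$. A thread is a club $D\subseteq\lambda$ with $D\cap\alpha\in\mathcal{C}_\alpha$ for all $\alpha\in\mathrm{acc}(D)$. A $\square(\lambda,<\eta)$-sequence is a coherent sequence of length $\lambda$ and width $<\eta$ with no thread. For a coherent sequence $\mathcal{C}$, let $A_{\mathcal{C}}$ be the set of $\alpha<\lambda$ for which there is a club $D_\alpha\subseteq\lambda$ such that for every $\beta\in D_\alpha$, $\alpha\in\bigcup_{C\in\mathcal{C}_\beta}\mathrm{acc}(C)$; $\mathcal{C}$ is full if $A_{\mathcal{C}}$ is unbounded in $\lambda$. A stationary $S\subseteq\lambda$ reflects at $\alpha<\lambda$ if $\mathrm{cf}(\alpha)>\omega$ and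 $S\cap\alpha$ is stationary in $\alpha$; a collection of stationary sets reflects simultaneously if there is one $\alpha<\lambda$ at which all reflect. $\mathrm{Refl}(<\kappa,S)$ says every collection of fewer than $\kappa$ stationary subsets of $S$ reflects simultaneously. -}

module Defs where

open import Level using (Level; suc)
open import Data.Nat.Base using (ℕ)
open import Data.Product.Base using (Σ-syntax; ∃-syntax; _×_; proj₁)
open import Function.Bundles using (Func; Injection; Bijection; _⇔_)
open import Induction.WellFounded using (WellFounded)
open import Relation.Binary.Bundles using (Setoid)
open import Relation.Binary.Core using (Rel)
open import Relation.Binary.Definitions using (_Respects_)
open import Relation.Binary.Structures using (IsStrictTotalOrder)
open import Relation.Binary.PropositionalEquality.Core using (_≡_)
open import Relation.Binary.PropositionalEquality.Properties using (setoid)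
open import Relation.Nullary.Construct.Add.Supremum using (_⁺; [_]; ⊤⁺)
open import Relation.Nullary.Negation.Core using (¬_)
open import Relation.Unary using (Pred; _∈_; _⊆_; _∩_; _≐_)
open import Relation.Unary.Relation.Binary.Equality using (≐-setoid)
import Relation.Binary.Construct.Add.Supremum.Strict as AddSupremum
import Relation.Binary.Construct.On as On
import Relation.Binary.Construct.StrictToNonStrict as StrictToNonStrict

record WellOrder (ℓ : Level) : Set (suc ℓ) where
  infix 4 _<_
  field
    Carrier            : Set ℓ
    _<_                : Rel Carrier ℓ
    isStrictTotalOrder : IsStrictTotalOrder _≡_ _<_
    wellFounded        : WellFounded _<_

-- The ordinal λ is given by a well-order: the elements of its carrier Λ are
-- the ordinals α < λ, and Λ ⁺ (Λ with a top element added) consists of the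
-- ordinals ≤ λ, the top element being λ itself.

module Ordinals {ℓ : Level} (W : WellOrder ℓ) where

  open WellOrder W public renaming (Carrier to Λ)
  open StrictToNonStrict _≡_ _<_ public using (_≤_)
  open AddSupremum _<_ public using (_<⁺_)

  Ordinal : Set ℓ
  Ordinal = Λ ⁺

  lam : Ordinal
  lam = ⊤⁺

  Subset : Set (suc ℓ)
  Subset = Pred Λ ℓ

  -- An ordinal δ ≤ λ as the set of its predecessors.
  ↓ : Ordinal → Subset
  ↓ δ β = [ β ] <⁺ δ

  ↓-setoid : Ordinal → Setoid ℓ ℓ
  ↓-setoid δ = On.setoid {B = Σ[ β ∈ Λ ] β ∈ ↓ δ} (setoid Λ) proj₁

  IsSuccessorOf : Λ → Λ → Set ℓ
  IsSuccessorOf β α = β < α × (∀ ξ → ξ < α → ξ ≤ β)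

  IsLimit : Λ → Set ℓ
  IsLimit β = (∃[ ξ ] ξ < β) × (∀ ξ → ξ < β → ∃[ ζ ] (ξ < ζ × ζ < β))

  IsOmega : Λ → Set ℓ
  IsOmega o = IsLimit o × (∀ ξ → ξ < o → ¬ IsLimit ξ)

  -- Least upper bound in the ordinals; in particular sup ∅ = 0.
  IsSup : Subset → Λ → Set ℓ
  IsSup A β = (∀ ξ → ξ ∈ A → ξ ≤ β)
            × (∀ υ → (∀ ξ → ξ ∈ A → ξ ≤ υ) → β ≤ υ)

  IsCardinal : Ordinal → Set ℓ
  IsCardinal δ = ∀ ξ → ξ <⁺ δ → ¬ Bijection (↓-setoid ξ) (↓-setoid δ)

  IsUncountable : Ordinal → Set ℓ
  IsUncountable δ = ¬ Injection (↓-setoid δ) (setoid ℕ)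

  CofinalMap : Ordinal → Ordinal → Set ℓ
  CofinalMap μ δ =
    Σ[ f ∈ Func (↓-setoid μ) (↓-setoid δ) ]
      (∀ β → β ∈ ↓ δ → ∃[ ν ] β ≤ proj₁ (Func.to f ν))

  -- IsCofinality δ μ says cf(δ) = μ.
  IsCofinality : Ordinal → Ordinal → Set ℓ
  IsCofinality δ μ = CofinalMap μ δ × (∀ ν → ν <⁺ μ → ¬ CofinalMap ν δ)

  IsRegular : Ordinal → Set ℓ
  IsRegular δ = IsCofinality δ δ

  UncountableCofinality : Ordinal → Set ℓ
  UncountableCofinality δ =
    ∃[ μ ] (IsCofinality δ μ × (∃[ o ] (IsOmega o × [ o ] <⁺ μ)))

  -- With ≤ rather than <, the notion also makes sense in successor ordinals:
  -- {β} is unbounded in β + 1.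
  UnboundedIn : ∀ {p} → Ordinal → Pred Λ p → Set _
  UnboundedIn δ A = ∀ β → β ∈ ↓ δ → ∃[ ξ ] (ξ ∈ A × β ≤ ξ)

  ClosedIn : Ordinal → Subset → Set ℓ
  ClosedIn δ A = ∀ β → β ∈ ↓ δ → IsLimit β → IsSup (A ∩ ↓ [ β ]) β → β ∈ A

  record IsClub (δ : Ordinal) (C : Subset) : Set ℓ where
    field
      subset    : C ⊆ ↓ δ
      closed    : ClosedIn δ C
      unbounded : UnboundedIn δ C

  IsStationary : Ordinal → Subset → Set (suc ℓ)
  IsStationary δ S = S ⊆ ↓ δ × (∀ C → IsClub δ C → ∃[ ξ ] ξ ∈ S ∩ C)

  -- The condition β < sup { α + 1 | α ∈ A } is written as
  -- "β ≤ α for some α ∈ A", since this supremum may be λ itself.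
  acc : Subset → Subset
  acc A β = (∃[ α ] (α ∈ A × β ≤ α)) × IsSup (A ∩ ↓ [ β ]) β

  -- Extensional equality _≐_ plays the role of equality of sets.
  record Collection : Set (suc (suc ℓ)) where
    field
      member   : Pred Subset (suc ℓ)
      respects : member Respects _≐_

  open Collection public

  infix 4 _∈ᶜ_
  _∈ᶜ_ : Subset → Collection → Set (suc ℓ)
  A ∈ᶜ 𝓕 = member 𝓕 A

  Collection-setoid : Collection → Setoid (suc ℓ) ℓ
  Collection-setoid 𝓕 = On.setoid {B = Σ[ A ∈ Subset ] A ∈ᶜ 𝓕} (≐-setoid Λ ℓ) proj₁

  -- |𝓕| < η, for a cardinal η ≤ λ.
  FewerThan : Ordinal → Collection → Set (suc ℓ)
  FewerThan η 𝓕 = ∃[ ξ ] (ξ <⁺ η × Bijection (Collection-setoid 𝓕) (↓-setoid ξ))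

  record IsCoherentSequence (η : Ordinal) (𝒞 : Λ → Collection) : Set (suc ℓ) where
    field
      nonempty  : ∀ α → ∃[ C ] C ∈ᶜ 𝒞 α
      width     : ∀ α → FewerThan η (𝒞 α)
      club      : ∀ α C → C ∈ᶜ 𝒞 α → IsClub [ α ] C
      successor : ∀ β α → IsSuccessorOf β α → ∀ C → C ∈ᶜ 𝒞 α ⇔ C ≐ (_≡ β)
      coherent  : ∀ β C → C ∈ᶜ 𝒞 β → ∀ α → α ∈ acc C → (C ∩ ↓ [ α ]) ∈ᶜ 𝒞 α

  IsThread : (Λ → Collection) → Subset → Set (suc ℓ)
  IsThread 𝒞 D = IsClub lam D × (∀ α → α ∈ acc D → (D ∩ ↓ [ α ]) ∈ᶜ 𝒞 α)

  IsSquareSequence : Ordinal → (Λ → Collection) → Set (suc ℓ)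
  IsSquareSequence η 𝒞 = IsCoherentSequence η 𝒞 × ¬ (∃[ D ] IsThread 𝒞 D)

  -- The set A_𝒞.
  AccPoints : (Λ → Collection) → Pred Λ (suc ℓ)
  AccPoints 𝒞 α =
    ∃[ D ] (IsClub lam D × (∀ β → β ∈ D → ∃[ C ] (C ∈ᶜ 𝒞 β × α ∈ acc C)))

  IsFull : (Λ → Collection) → Set (suc ℓ)
  IsFull 𝒞 = UnboundedIn lam (AccPoints 𝒞)

  ReflectsAt : Subset → Λ → Set (suc ℓ)
  ReflectsAt S α =
    UncountableCofinality [ α ] × IsStationary [ α ] (S ∩ ↓ [ α ])

  ReflectSimultaneously : Collection → Set (suc ℓ)
  ReflectSimultaneously 𝓣 = ∃[ α ] (∀ T → T ∈ᶜ 𝓣 → ReflectsAt T α)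

  Refl< : Ordinal → Subset → Set (suc (suc ℓ))
  Refl< κ S =
    ∀ (𝓣 : Collection) → FewerThan κ 𝓣 →
    (∀ T → T ∈ᶜ 𝓣 → T ⊆ S × IsStationary lam T) →
    ReflectSimultaneously 𝓣

{-# OPTIONS --safe #-}
module Submission where

-- Call C ∈ 𝒞 α an anchor at α if for club many β, β ∈ S implies that some
-- element of 𝒞 β has α as an accumulation point and C as its trace on α. If
-- Refl(<κ, S) holds, then every α ∈ A_𝒞 has an anchor. Choose one for each α:
-- end-extension makes the chosen anchors a tree. Any set of fewer than λ
-- anchors is covered by the fewer than κ branches given by the elements of a
-- single 𝒞 β, so the tree has no antichain of size κ. As κ < λ = cf(λ), a
-- Kurepa-style argument then yields a cofinal branch, whose union is a thread.

open import Axiom.ExcludedMiddle using (ExcludedMiddle)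
open import Data.Empty using (⊥; ⊥-elim)
open import Data.Product.Base using (Σ-syntax; ∃-syntax; _×_; _,_; proj₁; proj₂)
open import Data.Sum.Base using (_⊎_; inj₁; inj₂)
open import Function.Base using (id)
open import Function.Bundles using (Bijection)
open import Induction.WellFounded using (module All; module FixPoint)
open import Level using (Level; Lift; lift; lower)
open import Relation.Binary.Definitions using (tri<; tri≈; tri>)
open import Relation.Binary.PropositionalEquality.Core using (_≡_; refl; sym; trans; subst)
open import Relation.Binary.Structures using (module IsStrictTotalOrder)
open import Relation.Nullary.Construct.Add.Supremum using ([_])
open import Relation.Nullary.Decidable using (yes; no; True; toWitness; fromWitness)
open import Relation.Nullary.Negation.Core using (¬_)
open import Relation.Unary using (Pred; _∈_; _⊆_; _∩_; _≐_)
open import Relation.Unary.Properties using (≐-refl; ≐-sym; ≐-trans)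
open import Relation.Binary.Construct.Add.Supremum.Strict using ([_]; [_]<⊤⁺)
open import Defs

module Classical (em : ∀ {a} → ExcludedMiddle a) {ℓ : Level} (W : WellOrder ℓ) where

  open Ordinals W

  private
    module < = IsStrictTotalOrder isStrictTotalOrder

    variable
      p q : Level
      α β γ δ ξ η ζ : Λ

  -- Excluded middle and choice

  by-contradiction : {P : Set p} → ¬ ¬ P → P
  by-contradiction {P = P} ¬¬p with em {P = P}
  ... | yes p = p
  ... | no ¬p = ⊥-elim (¬¬p ¬p)

  -- Excluded middle gives resizing; subsets must be predicates of level ℓ.
  Small : Set p → Set ℓ
  Small P = Lift ℓ (True (em {P = P}))

  small : {P : Set p} → P → Small P
  small p = lift (fromWitness p)

  unsmall : {P : Set p} → Small P → P
  unsmall s = toWitness (lower s)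

  choose : {X : Set p} {P : Pred Λ q} {r : Level} (Q : Λ → X → Set r) → X →
           (∀ α → P α → ∃[ x ] Q α x) → ∃[ f ] (∀ α → P α → Q α (f α))
  choose {X = X} {P} Q x₀ h = (λ α → proj₁ (at α)) , (λ α → proj₂ (at α))
    where
    at : ∀ α → Σ[ x ∈ X ] (P α → Q α x)
    at α with em {P = P α}
    ... | yes p = proj₁ (h α p) , λ _ → proj₂ (h α p)
    ... | no ¬p = x₀ , λ p → ⊥-elim (¬p p)

  -- Order and least elements

  <-irrefl : ¬ α < α
  <-irrefl = <.irrefl refl

  ≤-refl : α ≤ α
  ≤-refl = inj₂ refl

  ≤-<-trans : α ≤ β → β < γ → α < γ
  ≤-<-trans (inj₁ p) q = <.trans p q
  ≤-<-trans (inj₂ refl) q = q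

  <-≤-trans : α < β → β ≤ γ → α < γ
  <-≤-trans p (inj₁ q) = <.trans p q
  <-≤-trans p (inj₂ refl) = p

  ≤-trans : α ≤ β → β ≤ γ → α ≤ γ
  ≤-trans (inj₁ p) q = inj₁ (<-≤-trans p q)
  ≤-trans (inj₂ refl) q = q

  ≤-antisym : α ≤ β → β ≤ α → α ≡ β
  ≤-antisym (inj₂ refl) _ = refl
  ≤-antisym (inj₁ p) q = ⊥-elim (<-irrefl (<-≤-trans p q))

  <-or-≥ : ∀ α β → α < β ⊎ β ≤ α
  <-or-≥ α β with <.compare α β
  ... | tri< p _ _ = inj₁ p
  ... | tri≈ _ e _ = inj₂ (inj₂ (sym e))
  ... | tri> _ _ p = inj₂ (inj₁ p)

  ≮⇒≥ : ¬ α < β → β ≤ α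
  ≮⇒≥ {α} {β} n with <-or-≥ α β
  ... | inj₁ p = ⊥-elim (n p)
  ... | inj₂ p = p

  ≰⇒> : ¬ α ≤ β → β < α
  ≰⇒> {α} {β} n with <-or-≥ β α
  ... | inj₁ p = p
  ... | inj₂ p = ⊥-elim (n p)

  least : (P : Pred Λ p) → ∃[ α ] P α → ∃[ α ] (P α × (∀ β → P β → α ≤ β))
  least P (α , pα) = by-contradiction λ none →
    All.wfRec wellFounded _ (λ β → ¬ P β)
      (λ β rec pβ → none (β , pβ , λ γ pγ → ≮⇒≥ λ γ<β → rec γ<β pγ)) α pα

  pick : Λ → Pred Λ p → Λ
  pick d P with em {P = ∃[ α ] P α}
  ... | yes e = proj₁ (least P e)
  ... | no _ = d

  pick-∈ : ∀ d (P : Pred Λ p) → ∃[ α ] P α → P (pick d P)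
  pick-∈ d P e with em {P = ∃[ α ] P α}
  ... | yes e′ = proj₁ (proj₂ (least P e′))
  ... | no ¬e = ⊥-elim (¬e e)

  -- A least element depends on the extension of the predicate alone. This lets `recursion` unfold
  -- without function extensionality.
  pick-cong : ∀ d (P Q : Pred Λ p) → P ≐ Q → pick d P ≡ pick d Q
  pick-cong d P Q (P⊆Q , Q⊆P) with em {P = ∃[ α ] P α} | em {P = ∃[ α ] Q α}
  ... | yes e | yes e′ = ≤-antisym
          (proj₂ (proj₂ (least P e)) _ (Q⊆P (proj₁ (proj₂ (least Q e′)))))
          (proj₂ (proj₂ (least Q e′)) _ (P⊆Q (proj₁ (proj₂ (least P e)))))
  ... | yes (α , e) | no ¬e = ⊥-elim (¬e (α , P⊆Q e))
  ... | no ¬e | yes (α , e) = ⊥-elim (¬e (α , Q⊆P e))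
  ... | no _ | no _ = refl

  -- Predecessor sets and limit points

  ↓-closed : ∀ {δ} → α < β → β ∈ ↓ δ → α ∈ ↓ δ
  ↓-closed p [ q ] = [ <.trans p q ]
  ↓-closed p [ _ ]<⊤⁺ = [ _ ]<⊤⁺

  ↓-max : ∀ {δ} α β → α ∈ ↓ δ → β ∈ ↓ δ → ∃[ γ ] (γ ∈ ↓ δ × α ≤ γ × β ≤ γ)
  ↓-max α β p q with <-or-≥ α β
  ... | inj₁ r = β , q , inj₁ r , ≤-refl
  ... | inj₂ r = α , p , ≤-refl , r

  ↓⁻¹ : α ∈ ↓ [ β ] → α < β
  ↓⁻¹ [ p ] = p

  ∈lam : α ∈ ↓ lam
  ∈lam = [ _ ]<⊤⁺

  -- The condition β = sup(X ∩ β) with explicit witnesses; like the supremum, it holds vacuously at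
  -- β = 0.
  LimitOf : Subset → Λ → Set ℓ
  LimitOf X β = ∀ ξ → ξ < β → ∃[ ζ ] (ζ ∈ X × ξ < ζ × ζ < β)

  limitOf⇒sup : ∀ {X} → LimitOf X β → IsSup (X ∩ ↓ [ β ]) β
  limitOf⇒sup {β} {X} lim = (λ { _ (_ , [ p ]) → inj₁ p }) , λ υ ub → ≮⇒≥ λ υ<β →
    let ζ , ζ∈X , υ<ζ , ζ<β = lim υ υ<β
    in <-irrefl (<-≤-trans υ<ζ (ub ζ (ζ∈X , [ ζ<β ])))

  sup⇒limitOf : ∀ {X} → IsSup (X ∩ ↓ [ β ]) β → LimitOf X β
  sup⇒limitOf (_ , lub) ξ ξ<β = by-contradiction λ none →
    <-irrefl (<-≤-trans ξ<β (lub ξ λ { ζ (ζ∈X , [ ζ<β ]) →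
      ≮⇒≥ λ ξ<ζ → none (ζ , ζ∈X , ξ<ζ , ζ<β) }))

  limitOf-mono : ∀ {X Y} → (∀ ξ → ξ < β → ξ ∈ X → ξ ∈ Y) → LimitOf X β → LimitOf Y β
  limitOf-mono X⊆Y lim ξ ξ<β =
    let ζ , ζ∈X , ξ<ζ , ζ<β = lim ξ ξ<β in ζ , X⊆Y ζ ζ<β ζ∈X , ξ<ζ , ζ<β

  -- Cofinality and recursion

  -- This is k < cf(δ), stated for total functions restricted to k. The bound is strict, so for
  -- nonempty k constant maps give points above a given one.
  Bounding : Ordinal → Λ → Set ℓ
  Bounding δ k = ∀ (h : Λ → Λ) → (∀ ξ → ξ < k → h ξ ∈ ↓ δ) →
                 ∃[ b ] (b ∈ ↓ δ × (∀ ξ → ξ < k → h ξ < b))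

  bounding : ∀ {δ k} → ¬ CofinalMap [ k ] δ → Bounding δ k
  bounding {δ} {k} ¬cof h h∈ = by-contradiction λ none → ¬cof
    ( record { to = λ { (ξ , [ p ]) → h ξ , h∈ ξ p }
             ; cong = λ { {_ , [ _ ]} {_ , [ _ ]} refl → refl } }
    , λ β β∈ → by-contradiction λ none′ → none
        (β , β∈ , λ ξ p → ≰⇒> λ β≤ → none′ ((ξ , [ p ]) , β≤)) )

  -- At stage ξ < k the earlier values of `g` along `f` are bounded in δ since ξ < cf(δ), and `Z ξ`
  -- has an element past the bound.
  recursion : ∀ δ k → (∀ ν → ν < k → Bounding δ ν) →
    (Z : Λ → Subset) → (∀ ξ → ξ < k → Z ξ ⊆ ↓ δ) → (∀ ξ → ξ < k → UnboundedIn δ (Z ξ)) →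
    (g : Λ → Λ) → (∀ ζ → ζ ∈ ↓ δ → g ζ ∈ ↓ δ) →
    ∃[ f ] (∀ ξ → ξ < k → f ξ ∈ Z ξ × (∀ η → η < ξ → g (f η) < f ξ))
  recursion δ k bnd Z Z⊆ unb g g∈ = f , λ ξ p → All.wfRec wellFounded _ Spec prove ξ p
    where
    Next : ∀ ξ → (∀ {η} → η < ξ → Λ) → Subset
    Next ξ ih z = z ∈ Z ξ × (∀ η (p : η < ξ) → g (ih p) < z)

    step : ∀ ξ → (∀ {η} → η < ξ → Λ) → Λ
    -- The default ξ is never returned at stages below k, where `prove` finds a candidate.
    step ξ ih = pick ξ (Next ξ ih)

    step-ext : ∀ ξ {ih ih′ : ∀ {η} → η < ξ → Λ} →
               (∀ {η} (p : η < ξ) → ih p ≡ ih′ p) → step ξ ih ≡ step ξ ih′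
    step-ext ξ eq = pick-cong ξ _ _
      ( (λ (z∈ , h) → z∈ , λ η p → subst (λ x → g x < _) (eq p) (h η p))
      , (λ (z∈ , h) → z∈ , λ η p → subst (λ x → g x < _) (sym (eq p)) (h η p)) )

    f : Λ → Λ
    f = All.wfRec wellFounded _ (λ _ → Λ) step

    Spec : Pred Λ ℓ
    Spec ξ = ξ < k → f ξ ∈ Z ξ × (∀ η → η < ξ → g (f η) < f ξ)

    prove : ∀ ξ → (∀ {η} → η < ξ → Spec η) → Spec ξ
    prove ξ ih ξ<k
      rewrite FixPoint.unfold-wfRec wellFounded (λ _ → Λ) step step-ext {ξ} =
      let b , b∈ , bound = bnd ξ ξ<k (λ η → g (f η))
                             λ η η<ξ → g∈ _ (Z⊆ η (<.trans η<ξ ξ<k) (proj₁ (ih η<ξ (<.trans η<ξ ξ<k))))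
          z , z∈ , b≤z = unb ξ ξ<k b b∈
      in pick-∈ ξ (Next ξ λ {η} _ → f η) (z , z∈ , λ η η<ξ → <-≤-trans (bound η η<ξ) b≤z)

  -- Clubs and stationary sets

  ↓-isClub : ∀ δ → IsClub δ (↓ δ)
  ↓-isClub δ = record
    { subset = id ; closed = λ _ β∈ _ _ → β∈ ; unbounded = λ β β∈ → β , β∈ , ≤-refl }

  tail-isClub : ∀ {δ C} b → b ∈ ↓ δ → IsClub δ C → IsClub δ (C ∩ (b ≤_))
  tail-isClub {δ} {C} b b∈ club = record
    { subset = λ (c , _) → IsClub.subset club c
    ; closed = λ β β∈ lim s →
        let l = sup⇒limitOf s
            ξ , ξ<β = proj₁ lim
            _ , (_ , b≤ζ) , _ , ζ<β = l ξ ξ<β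
        in IsClub.closed club β β∈ lim (limitOf⇒sup (limitOf-mono (λ _ _ → proj₁) l))
         , inj₁ (≤-<-trans b≤ζ ζ<β)
    ; unbounded = λ β β∈ →
        let m , m∈ , b≤m , β≤m = ↓-max b β b∈ β∈
            ξ , ξ∈ , m≤ξ = IsClub.unbounded club m m∈
        in ξ , (ξ∈ , ≤-trans b≤m m≤ξ) , ≤-trans β≤m m≤ξ
    }

  stationary-unbounded : ∀ {δ T} → IsStationary δ T → UnboundedIn δ T
  stationary-unbounded {δ} (_ , meets) β β∈ =
    let ξ , ξ∈T , _ , β≤ξ = meets _ (tail-isClub β β∈ (↓-isClub δ)) in ξ , ξ∈T , β≤ξ

  stationary-tail : ∀ {δ T} b → b ∈ ↓ δ → IsStationary δ T → IsStationary δ (T ∩ (b ≤_))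
  stationary-tail b b∈ (T⊆ , meets) = (λ (t , _) → T⊆ t) , λ C club →
    let ξ , ξ∈T , ξ∈C , b≤ξ = meets _ (tail-isClub b b∈ club) in ξ , (ξ∈T , b≤ξ) , ξ∈C

  reflectsAt-mono : ∀ {T U} → T ⊆ U → ReflectsAt T γ → ReflectsAt U γ
  reflectsAt-mono T⊆U (cf , _ , meets) = cf , proj₂ , λ C club →
    let ξ , (ξ∈T , ξ<γ) , ξ∈C = meets C club in ξ , (T⊆U ξ∈T , ξ<γ) , ξ∈C

  nonstationary : ∀ {δ T} → T ⊆ ↓ δ → ¬ IsStationary δ T →
                  ∃[ C ] (IsClub δ C × (∀ ξ → ξ ∈ C → ¬ ξ ∈ T))
  nonstationary T⊆ ¬stat = by-contradiction λ none → ¬stat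
    (T⊆ , λ C club → by-contradiction λ none′ →
      none (C , club , λ ξ ξ∈C ξ∈T → none′ (ξ , ξ∈T , ξ∈C)))

  -- The values of `G` stay below β only cofinally often, so that iterating a non-monotone `G`
  -- already produces such points.
  ClosedUnder : Ordinal → (Λ → Λ) → Subset
  ClosedUnder δ G β =
    β ∈ ↓ δ × (∀ ζ → ζ < β → ∃[ ζ′ ] (ζ ≤ ζ′ × ζ′ < β × G ζ′ < β))

  -- Iterating `G` along a limit ordinal o < cf(δ) gives a sequence whose least upper bound is
  -- closed under `G`.
  closedUnder-isClub : ∀ {δ o} → IsLimit o → (∀ ν → ν ≤ o → Bounding δ ν) →
    ∀ G → (∀ ζ → ζ ∈ ↓ δ → ζ < G ζ × G ζ ∈ ↓ δ) → IsClub δ (ClosedUnder δ G)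
  closedUnder-isClub {δ} {o} ((o₀ , o₀<o) , o-lim) bnd G infl = record
    { subset = proj₁
    ; closed = λ β β∈ _ s → β∈ , λ ζ ζ<β →
        let q , (_ , q-closed) , ζ<q , q<β = sup⇒limitOf s ζ ζ<β
            ζ′ , ζ≤ζ′ , ζ′<q , Gζ′<q = q-closed ζ ζ<q
        in ζ′ , ζ≤ζ′ , <.trans ζ′<q q<β , <.trans Gζ′<q q<β
    ; unbounded = unb
    }
    where
    unb : UnboundedIn δ (ClosedUnder δ G)
    unb b b∈ = ε , (ε∈ , ε-closed) , inj₁ (<.trans (proj₂ (proj₁ (f-spec o₀ o₀<o))) (f<ε o₀ o₀<o))
      where
      Z : Subset
      Z = ↓ δ ∩ (b <_)

      Z-unb : UnboundedIn δ Z
      Z-unb β β∈ =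
        let m , m∈ , b≤m , β≤m = ↓-max b β b∈ β∈
            m<Gm , Gm∈ = infl m m∈
        in G m , (Gm∈ , ≤-<-trans b≤m m<Gm) , inj₁ (≤-<-trans β≤m m<Gm)

      seq : ∃[ f ] (∀ ξ → ξ < o → f ξ ∈ Z × (∀ η → η < ξ → G (f η) < f ξ))
      seq = recursion δ o (λ ν ν<o → bnd ν (inj₁ ν<o)) (λ _ → Z) (λ _ _ → proj₁)
              (λ _ _ → Z-unb) G (λ ζ ζ∈ → proj₂ (infl ζ ζ∈))

      f : Λ → Λ
      f = proj₁ seq

      f-spec : ∀ ξ → ξ < o → f ξ ∈ Z × (∀ η → η < ξ → G (f η) < f ξ)
      f-spec = proj₂ seq

      Upper : Subset
      Upper x = x ∈ ↓ δ × (∀ ξ → ξ < o → f ξ < x)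

      sup : ∃[ ε ] (Upper ε × (∀ x → Upper x → ε ≤ x))
      sup = least Upper (bnd o ≤-refl f λ ξ ξ<o → proj₁ (proj₁ (f-spec ξ ξ<o)))

      ε : Λ
      ε = proj₁ sup

      ε∈ : ε ∈ ↓ δ
      ε∈ = proj₁ (proj₁ (proj₂ sup))

      f<ε : ∀ ξ → ξ < o → f ξ < ε
      f<ε = proj₂ (proj₁ (proj₂ sup))

      ε-closed : ∀ ζ → ζ < ε → ∃[ ζ′ ] (ζ ≤ ζ′ × ζ′ < ε × G ζ′ < ε)
      -- Below ε, ζ fails to bound the sequence, so ζ ≤ `f ξ` for some ξ; as o is a limit, `G (f ξ)`
      -- lies under a later value.
      ε-closed ζ ζ<ε = by-contradiction λ none →
        <-irrefl (<-≤-trans ζ<ε (proj₂ (proj₂ sup) ζ (↓-closed ζ<ε ε∈ , λ ξ ξ<o →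
          ≰⇒> λ ζ≤fξ → none (f ξ , ζ≤fξ , f<ε ξ ξ<o ,
            let ξ′ , ξ<ξ′ , ξ′<o = o-lim ξ ξ<o
            in <.trans (proj₂ (f-spec ξ′ ξ′<o) ξ ξ<ξ′) (f<ε ξ′ ξ′<o)))))

  -- A point of `X` that is reached between ζ and `G ζ` stays below β whenever `G ζ` does. This is
  -- how limit points of clubs are produced.
  limitOf-closedUnder : ∀ {δ G X} → ClosedUnder δ G β → α < β →
    (∀ ζ → ζ < β → α ≤ ζ → ∃[ d ] (d ∈ X × ζ < d × d ≤ G ζ)) → LimitOf X β
  limitOf-closedUnder {β} {α} {G = G} (β∈ , cl) α<β next ξ ξ<β =
    let m , m∈↓β , α≤m , ξ≤m = ↓-max α ξ [ α<β ] [ ξ<β ]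
        ζ , m≤ζ , ζ<β , Gζ<β = cl m (↓⁻¹ m∈↓β)
        d , d∈X , ζ<d , d≤Gζ = next ζ ζ<β (≤-trans α≤m m≤ζ)
    in d , d∈X , ≤-<-trans (≤-trans ξ≤m m≤ζ) ζ<d , ≤-<-trans d≤Gζ Gζ<β

  limitOf⇒IsLimit : ∀ {X} → α < β → LimitOf X β → IsLimit β
  limitOf⇒IsLimit α<β lim =
    (_ , α<β) , λ ξ ξ<β → let ζ , _ , ξ<ζ , ζ<β = lim ξ ξ<β in ζ , ξ<ζ , ζ<β

  limitOf-∈ : ∀ {δ X} → IsClub δ X → β ∈ ↓ δ → α < β → LimitOf X β → β ∈ X
  limitOf-∈ club β∈ α<β lim =
    IsClub.closed club _ β∈ (limitOf⇒IsLimit α<β lim) (limitOf⇒sup lim)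

  -- Cardinals

  -- The forward orbit under `h` of the interval from ξ₀ to k: on it the Cantor-Bernstein map is
  -- `h`, off it the identity.
  data OrbitOf (ξ₀ k : Λ) (h : Λ → Λ) : Pred Λ ℓ where
    base : ξ₀ ≤ ζ → ζ < k → OrbitOf ξ₀ k h ζ
    next : ζ < k → OrbitOf ξ₀ k h ζ → OrbitOf ξ₀ k h (h ζ)

  -- The Cantor–Bernstein argument for the inclusion of ξ₀ in k.
  no-injection : ∀ {k ξ₀} → IsCardinal [ k ] → ξ₀ < k → (h : Λ → Λ) →
    (∀ ξ → ξ < k → h ξ < ξ₀) → ¬ (∀ ξ η → ξ < k → η < k → h ξ ≡ h η → ξ ≡ η)
  no-injection {k} {ξ₀} card ξ₀<k h h< h-inj = card [ ξ₀ ] [ ξ₀<k ] bij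
    where
    Orbit : Subset
    Orbit = OrbitOf ξ₀ k h

    Graph : Λ → Λ → Set ℓ
    Graph η ξ = ξ < k × ((Orbit ξ × η ≡ h ξ) ⊎ (¬ Orbit ξ × η ≡ ξ))

    graph-inj : ∀ η {ξ ξ′} → Graph η ξ → Graph η ξ′ → ξ ≡ ξ′
    graph-inj _ (p , inj₁ (_ , refl)) (q , inj₁ (_ , e)) = h-inj _ _ p q e
    graph-inj _ (p , inj₁ (o , refl)) (_ , inj₂ (n , refl)) = ⊥-elim (n (next p o))
    graph-inj _ (_ , inj₂ (n , refl)) (q , inj₁ (o , refl)) = ⊥-elim (n (next q o))
    graph-inj _ (_ , inj₂ (_ , refl)) (_ , inj₂ (_ , refl)) = refl

    preimage : ∀ η → η < ξ₀ → ∃[ ξ ] Graph η ξ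
    preimage η η<ξ₀ with em {P = Orbit η}
    ... | yes (base ξ₀≤η _) = ⊥-elim (<-irrefl (<-≤-trans η<ξ₀ ξ₀≤η))
    ... | yes (next {ζ} ζ<k o) = ζ , ζ<k , inj₁ (o , refl)
    ... | no n = η , <.trans η<ξ₀ ξ₀<k , inj₂ (n , refl)

    image : ∀ ξ → ξ < k → ∃[ η ] (η < ξ₀ × Graph η ξ)
    image ξ ξ<k with em {P = Orbit ξ}
    ... | yes o = h ξ , h< ξ ξ<k , ξ<k , inj₁ (o , refl)
    ... | no n = ξ , ≰⇒> (λ ξ₀≤ξ → n (base ξ₀≤ξ ξ<k)) , ξ<k , inj₂ (n , refl)

    graph-fun : ∀ {η η′} ξ → Graph η ξ → Graph η′ ξ → η ≡ η′
    graph-fun _ (_ , inj₁ (_ , refl)) (_ , inj₁ (_ , refl)) = refl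
    graph-fun _ (_ , inj₁ (o , _)) (_ , inj₂ (n , _)) = ⊥-elim (n o)
    graph-fun _ (_ , inj₂ (n , _)) (_ , inj₁ (o , _)) = ⊥-elim (n o)
    graph-fun _ (_ , inj₂ (_ , refl)) (_ , inj₂ (_ , refl)) = refl

    bij : Bijection (↓-setoid [ ξ₀ ]) (↓-setoid [ k ])
    bij = record
      { to = λ { (η , [ p ]) → proj₁ (preimage η p) , [ proj₁ (proj₂ (preimage η p)) ] }
      ; cong = λ { {η , [ p ]} {_ , [ q ]} refl →
          graph-inj η (proj₂ (preimage η p)) (proj₂ (preimage η q)) }
      ; bijective =
          (λ { {η , [ p ]} {η′ , [ q ]} e → graph-fun _ (proj₂ (preimage η p))
                 (subst (Graph η′) (sym e) (proj₂ (preimage η′ q))) })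
        , λ { (ξ , [ p ]) → let η , η<ξ₀ , g = image ξ p in
              (η , [ η<ξ₀ ]) , λ { {_ , [ q ]} refl → graph-inj η (proj₂ (preimage η q)) g } }
      }

  -- If k had at most one element, a constant map into ℕ would be injective. Here η serves later as
  -- a nonempty index ordinal below k.
  uncountable⇒two : ∀ {k} → IsUncountable [ k ] → ∃[ ξ ] ∃[ η ] (ξ < η × η < k)
  uncountable⇒two {k} unc = by-contradiction λ none → unc record
    { to = λ _ → 0
    ; cong = λ _ → refl
    ; injective = λ { {ξ , [ p ]} {η , [ q ]} _ →
        ≤-antisym (≮⇒≥ λ η<ξ → none (η , ξ , η<ξ , p))
                  (≮⇒≥ λ ξ<η → none (ξ , η , ξ<η , q)) }
    }

  -- Cutting each T i below a point m i, with m strictly increasing, makes the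
  -- members of the collection pairwise distinct, so that it is indexed
  -- bijectively.
  reflect-family : ∀ {κ S ξ₀} → (∀ ν → Bounding lam ν) → Refl< κ S → [ ξ₀ ] <⁺ κ →
    (T : Λ → Subset) → (∀ i → i < ξ₀ → T i ⊆ S × IsStationary lam (T i)) →
    ∃[ γ ] (∀ i → i < ξ₀ → ReflectsAt (T i) γ)
  reflect-family {κ} {S} {ξ₀} bnd refl< ξ₀<κ T T-stat =
    let γ , r = refl< 𝓣 fewer λ { U (lift (i , i<ξ₀ , U⊆ , ⊆U)) →
                  (λ u → proj₁ (T-stat i i<ξ₀) (proj₁ (U⊆ u)))
                , (λ _ → ∈lam)
                , λ C club →
                    let ξ , ξ∈ , ξ∈C = proj₂ (stationary-tail (m i) ∈lam (proj₂ (T-stat i i<ξ₀))) C club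
                    in ξ , ⊆U ξ∈ , ξ∈C }
    in γ , λ i i<ξ₀ → reflectsAt-mono proj₁ (r (T′ i) (lift (i , i<ξ₀ , ≐-refl)))
    where
    seq : ∃[ f ] (∀ i → i < ξ₀ → f i ∈ T i × (∀ j → j < i → f j < f i))
    seq = recursion lam ξ₀ (λ ν _ → bnd ν) T (λ _ _ _ → ∈lam)
            (λ i i<ξ₀ → stationary-unbounded (proj₂ (T-stat i i<ξ₀))) id (λ _ → id)

    m : Λ → Λ
    m = proj₁ seq

    m-inj : ∀ {i j} → i < ξ₀ → j < ξ₀ → m i ≡ m j → i ≡ j
    m-inj {i} {j} p q e = ≤-antisym
      (≮⇒≥ λ j<i → <-irrefl (subst (_< m i) (sym e) (proj₂ (proj₂ seq i p) j j<i)))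
      (≮⇒≥ λ i<j → <-irrefl (subst (_< m j) e (proj₂ (proj₂ seq j q) i i<j)))

    T′ : Λ → Subset
    T′ i = T i ∩ (m i ≤_)

    m∈T′ : ∀ {i} → i < ξ₀ → m i ∈ T′ i
    m∈T′ p = proj₁ (proj₂ seq _ p) , ≤-refl

    𝓣 : Collection
    𝓣 = record
      { member = λ U → Lift _ (∃[ i ] (i < ξ₀ × U ≐ T′ i))
      ; respects = λ { U≐V (lift (i , p , e)) → lift (i , p , ≐-trans (≐-sym U≐V) e) }
      }

    fewer : FewerThan κ 𝓣
    fewer = [ ξ₀ ] , ξ₀<κ , record
      { to = λ { (_ , lift (i , p , _)) → i , [ p ] }
      ; cong = λ { {_ , lift (i , p , a , a′)} {_ , lift (j , q , b , b′)} (e , e′) →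
          m-inj p q (≤-antisym (proj₂ (a (e′ (b′ (m∈T′ q))))) (proj₂ (b (e (a′ (m∈T′ p)))))) }
      ; bijective =
          (λ { {_ , lift (i , p , a)} {_ , lift (_ , q , b)} refl → ≐-trans a (≐-sym b) })
        , λ { (i , [ p ]) → (T′ i , lift (i , p , ≐-refl)) , λ
              { {_ , lift (j , q , b , b′)} (e , e′) →
                m-inj q p (≤-antisym (proj₂ (b (e′ (m∈T′ p)))) (proj₂ (e (b′ (m∈T′ q))))) } }
      }

  -- Since o = ω lies below the cofinality μ, minimality of μ excludes cofinal maps from any ν ≤ o.
  uncountable-cofinality : ∀ {δ} → UncountableCofinality δ →
    ∃[ o ] (IsLimit o × (∀ ν → ν ≤ o → Bounding δ ν))
  uncountable-cofinality (μ , (_ , min) , o , (o-lim , _) , o<μ) =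
    o , o-lim , λ ν ν≤o → bounding (min [ ν ] (below ν≤o o<μ))
    where
    below : ∀ {μ} → α ≤ β → [ β ] <⁺ μ → [ α ] <⁺ μ
    below (inj₁ p) q = ↓-closed p q
    below (inj₂ refl) q = q

  -- Initial segments

  Extends : Λ → Subset → Subset → Set ℓ
  Extends α C X = α ∈ acc X × (X ∩ ↓ [ α ]) ≐ C

  extends-resp : ∀ {C X Y} → X ≐ Y → Extends α C X → Extends α C Y
  extends-resp (X⊆Y , Y⊆X) (((ζ , ζ∈X , α≤ζ) , s) , (a , b)) =
      ((ζ , X⊆Y ζ∈X , α≤ζ) , limitOf⇒sup (limitOf-mono (λ _ _ → X⊆Y) (sup⇒limitOf s)))
    , (λ (y , p) → a (Y⊆X y , p)) , λ c → let x , p = b c in X⊆Y x , p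

  -- Two cuts of the same set are comparable. This turns the anchors into a tree and lets an element
  -- of `𝒞 β` serve as a branch.
  extends-restrict : ∀ {B C X} → Extends α B X → Extends β C X → α < β → Extends α B C
  extends-restrict ((_ , sα) , (a , b)) ((_ , sβ) , (X⊆C , C⊆X)) α<β =
    let ζ , ζ∈X , α<ζ , ζ<β = sup⇒limitOf sβ _ α<β in
      ( (ζ , X⊆C (ζ∈X , [ ζ<β ]) , inj₁ α<ζ)
      , limitOf⇒sup (limitOf-mono (λ ξ ξ<α ξ∈X → X⊆C (ξ∈X , [ <.trans ξ<α α<β ])) (sup⇒limitOf sα)) )
    , (λ (ξ∈C , p) → a (proj₁ (C⊆X ξ∈C) , p))
    , λ ξ∈B → let ξ∈X , p = b ξ∈B in X⊆C (ξ∈X , ↓-closed (↓⁻¹ p) [ α<β ]) , p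

  extends-trans : ∀ {B C X} → α < β → Extends α B C → Extends β C X → Extends α B X
  extends-trans α<β (((ζ , ζ∈C , α≤ζ) , s) , (a , b)) (_ , (X⊆C , C⊆X)) =
      ( (ζ , proj₁ (C⊆X ζ∈C) , α≤ζ)
      , limitOf⇒sup (limitOf-mono (λ _ _ ξ∈C → proj₁ (C⊆X ξ∈C)) (sup⇒limitOf s)) )
    , (λ (ξ∈X , p) → a (X⊆C (ξ∈X , ↓-closed (↓⁻¹ p) [ α<β ]) , p))
    , λ ξ∈B → let ξ∈C , p = b ξ∈B in proj₁ (C⊆X ξ∈C) , p

  extends-< : ∀ {B C} → C ⊆ ↓ [ β ] → Extends α B C → α < β
  extends-< C⊆ (((_ , ζ∈C , α≤ζ) , _) , _) = ≤-<-trans α≤ζ (↓⁻¹ (C⊆ ζ∈C))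

  module _ {k : Λ} (card : IsCardinal [ k ]) (unc : IsUncountable [ k ])
           (bnd : ∀ ν → Bounding lam ν)
           {𝒞 : Λ → Collection} (coh : IsCoherentSequence [ k ] 𝒞) where

    open IsCoherentSequence coh

    above : ∀ b → ∃[ c ] b < c
    above b =
      let ξ , _ , ξ<η , η<k = uncountable⇒two unc
          -- As k is nonempty, a strict bound of the constant map lies above b.
          c , _ , b<c = bnd k (λ _ → b) (λ _ _ → ∈lam)
      in c , b<c ξ (<.trans ξ<η η<k)

    -- Clubs in λ and points of reflection

    module Reflecting {S : Subset} (S-stat : IsStationary lam S) (refl< : Refl< [ k ] S) where

      -- The limit ordinal comes from reflection itself: a point at which `S` reflects has
      -- uncountable cofinality, which exhibits ω.
      limit : ∃[ o ] IsLimit o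
      limit =
        let ξ , η , ξ<η , η<k = uncountable⇒two unc
            _ , r = reflect-family bnd refl< [ η<k ] (λ _ → S) (λ _ _ → id , S-stat)
            o , o-lim , _ = uncountable-cofinality (proj₁ (r ξ ξ<η))
        in o , o-lim

      closedUnder-isClub-lam : ∀ G → (∀ ζ → ζ < G ζ) → IsClub lam (ClosedUnder lam G)
      closedUnder-isClub-lam G infl =
        closedUnder-isClub (proj₂ limit) (λ ν _ → bnd ν) G λ ζ _ → infl ζ , ∈lam

      club-above : ∀ {D} → IsClub lam D → ∀ ζ → ∃[ d ] (d ∈ D × ζ < d)
      club-above club ζ =
        let c , ζ<c = above ζ
            d , d∈D , c≤d = IsClub.unbounded club c ∈lam
        in d , d∈D , <-≤-trans ζ<c c≤d

      -- `G ζ` is past the chosen points of both clubs after ζ, so a point above b that is closed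
      -- under `G` is a limit of both.
      ∩-isClub : ∀ {D D′} → IsClub lam D → IsClub lam D′ → IsClub lam (D ∩ D′)
      ∩-isClub {D} {D′} club club′ = record
        { subset = λ _ → ∈lam
        ; closed = λ β β∈ lim s →
            let l = sup⇒limitOf s in
              IsClub.closed club β β∈ lim (limitOf⇒sup (limitOf-mono (λ _ _ → proj₁) l))
            , IsClub.closed club′ β β∈ lim (limitOf⇒sup (limitOf-mono (λ _ _ → proj₂) l))
        ; unbounded = λ b _ →
            let b⁺ , b<b⁺ = above b
                β , β-closed , b⁺≤β = IsClub.unbounded
                  (closedUnder-isClub-lam G λ ζ → <-≤-trans (proj₂ (proj₂ (d ζ))) (d≤G ζ)) b⁺ ∈lam
                b<β = <-≤-trans b<b⁺ b⁺≤β
            in β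
             , ( limitOf-∈ club ∈lam b<β (limitOf-closedUnder β-closed b<β λ ζ _ _ →
                   proj₁ (d ζ) , proj₁ (proj₂ (d ζ)) , proj₂ (proj₂ (d ζ)) , d≤G ζ)
               , limitOf-∈ club′ ∈lam b<β (limitOf-closedUnder β-closed b<β λ ζ _ _ →
                   proj₁ (d′ ζ) , proj₁ (proj₂ (d′ ζ)) , proj₂ (proj₂ (d′ ζ)) , d′≤G ζ) )
             , inj₁ b<β
        }
        where
        d : ∀ ζ → ∃[ x ] (x ∈ D × ζ < x)
        d = club-above club

        d′ : ∀ ζ → ∃[ x ] (x ∈ D′ × ζ < x)
        d′ = club-above club′

        G : Λ → Λ
        G ζ = proj₁ (↓-max (proj₁ (d ζ)) (proj₁ (d′ ζ)) ∈lam ∈lam)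

        d≤G : ∀ ζ → proj₁ (d ζ) ≤ G ζ
        d≤G ζ = proj₁ (proj₂ (proj₂ (↓-max (proj₁ (d ζ)) (proj₁ (d′ ζ)) ∈lam ∈lam)))

        d′≤G : ∀ ζ → proj₁ (d′ ζ) ≤ G ζ
        d′≤G ζ = proj₂ (proj₂ (proj₂ (↓-max (proj₁ (d ζ)) (proj₁ (d′ ζ)) ∈lam ∈lam)))

      -- Diagonal intersection: `G ζ` bounds chosen points after ζ of all `D α` with α ≤ ζ, so a β
      -- closed under `G` is a limit of every `D α` with α < β.
      meets-clubs : (D : Λ → Subset) → (∀ α → IsClub lam (D α)) →
        ∀ b → ∃[ β ] (β ∈ S × b ≤ β × (∀ α → α < b → β ∈ D α))
      meets-clubs D club b =
        let β , β∈S , β-closed , b≤β =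
              proj₂ S-stat _ (tail-isClub b ∈lam (closedUnder-isClub-lam G (λ ζ → proj₁ (G-spec ζ))))
        in β , β∈S , b≤β , λ α α<b →
             let α<β = <-≤-trans α<b b≤β in
             limitOf-∈ (club α) ∈lam α<β (limitOf-closedUnder β-closed α<β λ ζ _ α≤ζ →
               let d , d∈ , ζ<d = club-above (club α) ζ in d , d∈ , ζ<d , proj₂ (G-spec ζ) α α≤ζ)
        where
        dominate : ∀ ζ → ∃[ g ] (ζ < g × (∀ α → α ≤ ζ → proj₁ (club-above (club α) ζ) ≤ g))
        dominate ζ =
          -- `Bounding` speaks of strict predecessors, so α ≤ ζ is replaced by α < ζ⁺.
          let ζ⁺ , ζ<ζ⁺ = above ζ
              g , _ , bound = bnd ζ⁺ (λ α → proj₁ (club-above (club α) ζ)) (λ _ _ → ∈lam)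
          in g
           , <.trans (proj₂ (proj₂ (club-above (club ζ) ζ))) (bound ζ ζ<ζ⁺)
           , λ α α≤ζ → inj₁ (bound α (≤-<-trans α≤ζ ζ<ζ⁺))

        G : Λ → Λ
        G ζ = proj₁ (dominate ζ)

        G-spec : ∀ ζ → ζ < G ζ × (∀ α → α ≤ ζ → proj₁ (club-above (club α) ζ) ≤ G ζ)
        G-spec ζ = proj₂ (dominate ζ)

      -- Stationarity makes `T` unbounded in γ, so γ is a limit of the closed set `D`.
      reflection-point : ∀ {T D} → IsClub lam D → T ⊆ D → ReflectsAt T γ → γ ∈ D
      reflection-point {γ} {T} {D} club T⊆D (cf , T-stat) =
        let ζ , (_ , ζ<γ) , _ = proj₂ T-stat _ (↓-isClub [ γ ])
        in limitOf-∈ club ∈lam (↓⁻¹ ζ<γ) lim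
        where
        lim : LimitOf D γ
        lim ξ ξ<γ =
          let o , ((o₀ , o₀<o) , _) , bndγ = uncountable-cofinality cf
              -- The constant map on o has a strict bound below γ, so γ has no largest predecessor.
              ξ⁺ , ξ⁺∈γ , ξ<ξ⁺ = bndγ o ≤-refl (λ _ → ξ) (λ _ _ → [ ξ<γ ])
              ζ , (ζ∈T , ζ∈γ) , ξ⁺≤ζ = stationary-unbounded T-stat ξ⁺ ξ⁺∈γ
          in ζ , T⊆D ζ∈T , <-≤-trans (ξ<ξ⁺ o₀ o₀<o) ξ⁺≤ζ , ↓⁻¹ ζ∈γ

      -- As cf(γ) > ω, the points closed under a map sending each ζ to a larger element of `E` form
      -- a club in γ, which `T` meets.
      reflection-limit : ∀ {T E} → ReflectsAt T γ → IsClub [ γ ] E →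
                         ∃[ β ] (β ∈ T × β < γ × LimitOf E β)
      reflection-limit {γ} {T} {E} (cf , T-stat) club =
        let β , (β∈T , β∈γ) , β-closed = proj₂ T-stat _ (closedUnder-isClub o-lim bndγ G G-infl)
        in β , β∈T , ↓⁻¹ β∈γ , λ ξ ξ<β →
             limitOf-closedUnder β-closed ξ<β (λ ζ ζ<β _ →
               let ζ<G , G∈E = G-spec ζ (↓-closed ζ<β β∈γ) in G ζ , G∈E , ζ<G , ≤-refl) ξ ξ<β
        where
        o-data : ∃[ o ] (IsLimit o × (∀ ν → ν ≤ o → Bounding [ γ ] ν))
        o-data = uncountable-cofinality cf

        o-lim : IsLimit (proj₁ o-data)
        o-lim = proj₁ (proj₂ o-data)

        bndγ : ∀ ν → ν ≤ proj₁ o-data → Bounding [ γ ] ν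
        bndγ = proj₂ (proj₂ o-data)

        next-in-E : ∃[ G ] (∀ ζ → ζ ∈ ↓ [ γ ] → ζ < G ζ × G ζ ∈ E)
        next-in-E = choose (λ ζ e → ζ < e × e ∈ E) γ λ ζ ζ∈γ →
          let (o₀ , o₀<o) , _ = o-lim
              ζ⁺ , ζ⁺∈γ , ζ<ζ⁺ = bndγ (proj₁ o-data) ≤-refl (λ _ → ζ) (λ _ _ → ζ∈γ)
              e , e∈E , ζ⁺≤e = IsClub.unbounded club ζ⁺ ζ⁺∈γ
          in e , <-≤-trans (ζ<ζ⁺ o₀ o₀<o) ζ⁺≤e , e∈E

        G : Λ → Λ
        G = proj₁ next-in-E

        G-spec : ∀ ζ → ζ ∈ ↓ [ γ ] → ζ < G ζ × G ζ ∈ E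
        G-spec = proj₂ next-in-E

        G-infl : ∀ ζ → ζ ∈ ↓ [ γ ] → ζ < G ζ × G ζ ∈ ↓ [ γ ]
        G-infl ζ ζ∈γ = proj₁ (G-spec ζ ζ∈γ) , IsClub.subset club (proj₂ (G-spec ζ ζ∈γ))

      -- Anchors

      Anchored : Λ → Subset → Subset → Set _
      Anchored α C D = C ∈ᶜ 𝒞 α × IsClub lam D ×
        (∀ β → β ∈ S → β ∈ D → α < β → ∃[ E ] (E ∈ᶜ 𝒞 β × Extends α C E))

      -- Otherwise, for each C ∈ 𝒞 α, stationarily many β ∈ S have no element of
      -- 𝒞 β extending C; these sets reflect simultaneously at some γ ∈ D, and
      -- E ∈ 𝒞 γ with α ∈ acc E contradicts the reflection for C = E ∩ α.
      anchor : ∀ α → α ∈ AccPoints 𝒞 → ∃[ C ] ∃[ D ] Anchored α C D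
      anchor α (D , D-club , D-acc) = by-contradiction λ none →
        let stat : ∀ C → C ∈ᶜ 𝒞 α → IsStationary lam (T C)
            stat C C∈ = by-contradiction λ ¬stat →
              let D′ , D′-club , disj = nonstationary {T = T C} (λ _ → ∈lam) ¬stat
              in none (C , D ∩ D′ , C∈ , ∩-isClub D-club D′-club , λ β β∈S (β∈D , β∈D′) α<β →
                   by-contradiction λ ¬E → disj β β∈D′ (β∈S , β∈D , α<β , small ¬E))
        in refute stat (width α)
        where
        T : Subset → Subset
        T C β = β ∈ S × β ∈ D × α < β × Small (¬ (∃[ E ] (E ∈ᶜ 𝒞 β × Extends α C E)))

        refute : (∀ C → C ∈ᶜ 𝒞 α → IsStationary lam (T C)) → ¬ FewerThan [ k ] (𝒞 α)
        refute stat ([ ξ₀ ] , ξ₀<k , bij) =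
          let Cs , Cs-spec = enum
              γ , r = reflect-family bnd refl< ξ₀<k (λ i → T (Cs i))
                        λ i i<ξ₀ → proj₁ , stat (Cs i) (proj₁ (Cs-spec i i<ξ₀))
              C₀ , C₀∈ = nonempty α
              i₀ , i₀∈ = Bijection.to bij (C₀ , C₀∈)
              γ∈D = reflection-point D-club (λ t → proj₁ (proj₂ t)) (r i₀ (↓⁻¹ i₀∈))
              E , E∈ , α∈E = D-acc γ γ∈D
              E∩α∈ = coherent γ E E∈ α α∈E
              i , i∈ = Bijection.to bij (E ∩ ↓ [ α ] , E∩α∈)
              Cᵢ∈ , e = Cs-spec i (↓⁻¹ i∈)
              Cᵢ≐ : (E ∩ ↓ [ α ]) ≐ Cs i
              Cᵢ≐ = Bijection.injective bij {E ∩ ↓ [ α ] , E∩α∈} {Cs i , Cᵢ∈} (sym e)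
              -- As a limit of `E`, β has `E ∩ ↓ [ β ]` in `𝒞 β` by coherence. That set extends
              -- `Cs i`, which membership of β in `T (Cs i)` denies.
              β , (_ , _ , α<β , ¬E) , β<γ , β-lim = reflection-limit (r i (↓⁻¹ i∈)) (club γ E E∈)
              ζ , ζ∈E , β≤ζ = IsClub.unbounded (club γ E E∈) β [ β<γ ]
              β∈E : β ∈ acc E
              β∈E = (ζ , ζ∈E , β≤ζ) , limitOf⇒sup β-lim
          in unsmall ¬E (E ∩ ↓ [ β ] , coherent γ E E∈ β β∈E
                        , extends-restrict (α∈E , Cᵢ≐) (β∈E , ≐-refl) α<β)
          where
          enum : ∃[ Cs ] (∀ i → i < ξ₀ →
                   Σ[ C∈ ∈ Cs i ∈ᶜ 𝒞 α ] proj₁ (Bijection.to bij (Cs i , C∈)) ≡ i)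
          enum = choose (λ i C → Σ[ C∈ ∈ C ∈ᶜ 𝒞 α ] proj₁ (Bijection.to bij (C , C∈)) ≡ i) (↓ lam) λ i i<ξ₀ →
            let (C , C∈) , eq = Bijection.surjective bij (i , [ i<ξ₀ ])
            in C , C∈ , eq {C , C∈} ≐-refl

      -- `meets-clubs` finds one β ∈ S in the clubs of all anchors below b, so `𝒞 β` alone covers
      -- them. Outside `AccPoints 𝒞` the club is all of λ.
      anchor-system : ∃[ N ] ((∀ α → α ∈ AccPoints 𝒞 → N α ∈ᶜ 𝒞 α) ×
        (∀ b → ∃[ β ] (∀ α → α ∈ AccPoints 𝒞 → α < b →
           ∃[ E ] (E ∈ᶜ 𝒞 β × Extends α (N α) E))))
      anchor-system = N , (λ α a → proj₁ (N-anchored α a)) , λ b →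
        let β , β∈S , b≤β , β∈D = meets-clubs D D-club b
        in β , λ α a α<b →
             proj₂ (proj₂ (N-anchored α a)) β β∈S (β∈D α α<b) (<-≤-trans α<b b≤β)
        where
        at : ∀ α → ∃[ C ] ∃[ D ] (IsClub lam D × (α ∈ AccPoints 𝒞 → Anchored α C D))
        at α with em {P = α ∈ AccPoints 𝒞}
        ... | yes a = let C , D , anc = anchor α a in C , D , proj₁ (proj₂ anc) , λ _ → anc
        ... | no ¬a = ↓ lam , ↓ lam , ↓-isClub lam , λ a → ⊥-elim (¬a a)

        N D : Λ → Subset
        N α = proj₁ (at α)
        D α = proj₁ (proj₂ (at α))

        D-club : ∀ α → IsClub lam (D α)
        D-club α = proj₁ (proj₂ (proj₂ (at α)))

        N-anchored : ∀ α → α ∈ AccPoints 𝒞 → Anchored α (N α) (D α)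
        N-anchored α = proj₂ (proj₂ (proj₂ (at α)))

    -- The tree of anchors

    module Tree {A : Subset} (A-unb : UnboundedIn lam A)
                (N : Λ → Subset) (N∈ : ∀ α → α ∈ A → N α ∈ᶜ 𝒞 α)
                (cover : ∀ b → ∃[ β ] (∀ α → α ∈ A → α < b →
                           ∃[ E ] (E ∈ᶜ 𝒞 β × Extends α (N α) E))) where

      infix 4 _⊏_
      _⊏_ : Λ → Λ → Set ℓ
      α ⊏ β = Extends α (N α) (N β)

      ⊏⇒< : β ∈ A → α ⊏ β → α < β
      ⊏⇒< {β} β∈A = extends-< (IsClub.subset (club β (N β) (N∈ β β∈A)))

      ⊏-trans : β ∈ A → α ⊏ β → β ⊏ γ → α ⊏ γ
      ⊏-trans β∈A α⊏β = extends-trans (⊏⇒< β∈A α⊏β) α⊏β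

      -- Pigeonhole: all k nodes are cuts of elements of one `𝒞 β`, which has fewer than k elements.
      -- Two nodes cut from the same element are comparable.
      no-antichain : (z : Λ → Λ) → (∀ ξ → ξ < k → z ξ ∈ A) →
        (∀ ξ η → ξ < η → η < k → z ξ < z η) → ¬ (∀ ξ η → ξ < η → η < k → ¬ z ξ ⊏ z η)
      no-antichain z z∈A z-mono anti =
        let b , _ , z<b = bnd k z (λ _ _ → ∈lam)
            β , covers = cover b
        in refute β (λ ξ ξ<k → covers (z ξ) (z∈A ξ ξ<k) (z<b ξ ξ<k)) (width β)
        where
        refute : ∀ β → (∀ ξ → ξ < k → ∃[ E ] (E ∈ᶜ 𝒞 β × Extends (z ξ) (N (z ξ)) E)) →
                 ¬ FewerThan [ k ] (𝒞 β)
        refute β covers ([ ξ₀ ] , [ ξ₀<k ] , bij) =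
          no-injection card ξ₀<k h
            (λ ξ ξ<k → let _ , _ , _ , h<ξ₀ , _ = h-spec ξ ξ<k in h<ξ₀)
            λ ξ η ξ<k η<k e → ≤-antisym (≮⇒≥ λ η<ξ → distinct η<ξ ξ<k (sym e))
                                        (≮⇒≥ λ ξ<η → distinct ξ<η η<k e)
          where
          Index : Λ → Λ → Set _
          Index ξ i = ∃[ E ] Σ[ E∈ ∈ E ∈ᶜ 𝒞 β ]
            (Extends (z ξ) (N (z ξ)) E × i < ξ₀ × proj₁ (Bijection.to bij (E , E∈)) ≡ i)

          indexed : ∃[ h ] (∀ ξ → ξ < k → Index ξ (h ξ))
          indexed = choose Index k λ ξ ξ<k →
            let E , E∈ , ext = covers ξ ξ<k
                i , i∈ = Bijection.to bij (E , E∈)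
            in i , E , E∈ , ext , ↓⁻¹ i∈ , refl

          h : Λ → Λ
          h = proj₁ indexed

          h-spec : ∀ ξ → ξ < k → Index ξ (h ξ)
          h-spec = proj₂ indexed

          distinct : ξ < η → η < k → ¬ h ξ ≡ h η
          distinct {ξ} {η} ξ<η η<k e =
            let E , E∈ , ext , _ , i≡ = h-spec ξ (<.trans ξ<η η<k)
                E′ , E′∈ , ext′ , _ , i′≡ = h-spec η η<k
                E≐E′ = Bijection.injective bij {E , E∈} {E′ , E′∈} (trans i≡ (trans e (sym i′≡)))
            in anti ξ η ξ<η η<k
                 (extends-restrict (extends-resp E≐E′ ext) ext′ (z-mono ξ η ξ<η η<k))

      -- The thread is the union of the branch. Its part below β ∈ B is `N β`, an element of `𝒞 β`,
      -- so coherence passes to its accumulation points.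
      chain⇒thread : (B : Subset) → B ⊆ A → UnboundedIn lam B →
        (∀ u v → u ∈ B → v ∈ B → u < v → u ⊏ v) → ∃[ D ] IsThread 𝒞 D
      chain⇒thread B B⊆A B-unb chain = D , D-club , D-thread
        where
        D : Subset
        D ξ = ∃[ β ] (β ∈ B × ξ ∈ N β)

        B-above : ∀ ξ → ∃[ β ] (β ∈ B × ξ < β)
        B-above ξ =
          let ξ⁺ , ξ<ξ⁺ = above ξ
              β , β∈B , ξ⁺≤β = B-unb ξ⁺ ∈lam
          in β , β∈B , <-≤-trans ξ<ξ⁺ ξ⁺≤β

        N-club : β ∈ B → IsClub [ β ] (N β)
        N-club β∈B = club _ _ (N∈ _ (B⊆A β∈B))

        D∩β⊆N : β ∈ B → ∀ ξ → ξ < β → ξ ∈ D → ξ ∈ N β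
        D∩β⊆N {β} β∈B ξ ξ<β (β′ , β′∈B , ξ∈) with <.compare β′ β
        ... | tri< p _ _ = proj₁ (proj₂ (proj₂ (chain β′ β β′∈B β∈B p)) ξ∈)
        ... | tri≈ _ refl _ = ξ∈
        ... | tri> _ _ p = proj₁ (proj₂ (chain β β′ β∈B β′∈B p)) (ξ∈ , [ ξ<β ])

        D-club : IsClub lam D
        D-club = record
          { subset = λ _ → ∈lam
          ; closed = λ ξ _ lim s →
              let β , β∈B , ξ<β = B-above ξ in
              β , β∈B , IsClub.closed (N-club β∈B) ξ [ ξ<β ] lim
                (limitOf⇒sup (limitOf-mono (λ ζ ζ<ξ → D∩β⊆N β∈B ζ (<.trans ζ<ξ ξ<β)) (sup⇒limitOf s)))
          ; unbounded = λ ξ _ →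
              let β , β∈B , ξ<β = B-above ξ
                  ζ , ζ∈ , ξ≤ζ = IsClub.unbounded (N-club β∈B) ξ [ ξ<β ]
              in ζ , (β , β∈B , ζ∈) , ξ≤ζ
          }

        D-thread : ∀ α → α ∈ acc D → (D ∩ ↓ [ α ]) ∈ᶜ 𝒞 α
        D-thread α ((ζ , ζ∈D , α≤ζ) , s) =
          let β , β∈B , ζ<β = B-above ζ
              α<β = ≤-<-trans α≤ζ ζ<β
              α∈ = (ζ , D∩β⊆N β∈B ζ ζ<β ζ∈D , α≤ζ)
                 , limitOf⇒sup (limitOf-mono (λ ξ ξ<α → D∩β⊆N β∈B ξ (<.trans ξ<α α<β)) (sup⇒limitOf s))
          in respects (𝒞 α)
               ( (λ (ξ∈ , p) → (β , β∈B , ξ∈) , p)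
               , (λ (ξ∈ , p) → D∩β⊆N β∈B _ (<.trans (↓⁻¹ p) α<β) ξ∈ , p) )
               (coherent β (N β) (N∈ β (B⊆A β∈B)) α α∈)

      -- Splitting in a tree without a cofinal branch

      module Unthreaded (no-thread : ¬ (∃[ D ] IsThread 𝒞 D)) where

        -- Otherwise for every s some y ≥ s above α extends all nodes above α of height below s.
        -- Then the nodes above α form a cofinal branch.
        escape : ∀ α → α ∈ A → ∃[ s ] (∀ y → y ∈ A → s ≤ y → α ⊏ y →
                   ∃[ z ] (z ∈ A × α ⊏ z × z < s × ¬ z ⊏ y))
        escape α α∈A = by-contradiction λ none → no-thread
          (chain⇒thread (λ β → β ∈ A × α ⊏ β) proj₁
            (λ b _ → by-contradiction λ bounded → none
              (b , λ y y∈A b≤y α⊏y → ⊥-elim (bounded (y , (y∈A , α⊏y) , b≤y))))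
            λ u v (u∈A , α⊏u) (v∈A , α⊏v) u<v → by-contradiction λ u⋢v →
              let s , v<s = above v in none
              (s , λ y y∈A s≤y α⊏y → by-contradiction λ none′ →
                let v⊏y = by-contradiction λ v⋢y → none′ (v , v∈A , α⊏v , v<s , v⋢y)
                    u⊏y = by-contradiction λ u⋢y → none′ (u , u∈A , α⊏u , <.trans u<v v<s , u⋢y)
                in u⋢v (extends-restrict u⊏y v⊏y u<v)))

        Root : Λ → Subset
        Root δ α = α ∈ A × δ ≤ α × (∀ β → β ∈ A → δ ≤ β → ¬ β ⊏ α)

        -- Distinct roots are incomparable, so unboundedly many would yield an increasing antichain
        -- of length k.
        roots-bounded : ∀ δ → ∃[ t ] (∀ α → α ∈ Root δ → α < t)
        roots-bounded δ = by-contradiction λ none →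
          let f , f-spec = recursion lam k (λ ν _ → bnd ν) (λ _ → Root δ) (λ _ _ _ → ∈lam)
                (λ _ _ b _ → by-contradiction λ none′ → none
                  (b , λ α r → ≰⇒> λ b≤α → none′ (α , r , b≤α)))
                id (λ _ → id)
          in no-antichain f (λ ξ ξ<k → proj₁ (proj₁ (f-spec ξ ξ<k)))
               (λ ξ η ξ<η η<k → proj₂ (f-spec η η<k) ξ ξ<η)
               λ ξ η ξ<η η<k →
                 let fξ∈A , δ≤fξ , _ = proj₁ (f-spec ξ (<.trans ξ<η η<k))
                     _ , _ , minimal = proj₁ (f-spec η η<k)
                 in minimal (f ξ) fξ∈A δ≤fξ

        root-below : ∀ δ y → y ∈ A → δ ≤ y → ∃[ r ] (r ∈ Root δ × (r ⊏ y ⊎ r ≡ y))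
        root-below δ y y∈A δ≤y =
          let r , (r∈A , δ≤r , r⊑y) , min =
                least (λ α → α ∈ A × δ ≤ α × (α ⊏ y ⊎ α ≡ y)) (y , y∈A , δ≤y , inj₂ refl)
          in r , (r∈A , δ≤r , λ β β∈A δ≤β β⊏r →
               <-irrefl (<-≤-trans (⊏⇒< r∈A β⊏r) (min β (β∈A , δ≤β , inj₁ (below r∈A β⊏r r⊑y))))) , r⊑y
          where
          below : ∀ {α r} → r ∈ A → α ⊏ r → r ⊏ y ⊎ r ≡ y → α ⊏ y
          below r∈A α⊏r (inj₁ r⊏y) = ⊏-trans r∈A α⊏r r⊏y
          below _ α⊏r (inj₂ refl) = α⊏r

        -- A node `z` that leaves the branch below `y` after `r`, where `r` and `z` have heights
        -- between δ and g.
        record Fork (δ g y z : Λ) : Set ℓ where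
          field
            r   : Λ
            r∈A : r ∈ A
            δ≤r : δ ≤ r
            r⊏y : r ⊏ y
            z∈A : z ∈ A
            r⊏z : r ⊏ z
            z<g : z < g
            z⋢y : ¬ z ⊏ y

        -- The roots for δ are bounded, so by regularity some g is past all of them and past their
        -- bounds from `escape`. A node y of height at least g then lies strictly above a root, from
        -- which `escape` provides the fork.
        fork : ∀ δ → ∃[ g ] (∀ y → y ∈ A → g ≤ y → ∃[ z ] Fork δ g y z)
        fork δ =
          let t , t-bound = roots-bounded δ
              s , s-spec = choose (λ α s → ∀ y → y ∈ A → s ≤ y → α ⊏ y →
                             ∃[ z ] (z ∈ A × α ⊏ z × z < s × ¬ z ⊏ y)) δ escape
              g₀ , _ , s<g₀ = bnd t s (λ _ _ → ∈lam)
              g₁ , _ , t≤g₁ , g₀≤g₁ = ↓-max {lam} t g₀ ∈lam ∈lam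
              g , _ , g₁≤g , δ≤g = ↓-max {lam} g₁ δ ∈lam ∈lam
          in g , λ y y∈A g≤y →
            let r , r-root , r⊑y = root-below δ y y∈A (≤-trans δ≤g g≤y)
                r∈A , δ≤r , _ = r-root
                r<t = t-bound r r-root
                r⊏y = strict (<-≤-trans r<t (≤-trans t≤g₁ (≤-trans g₁≤g g≤y))) r⊑y
                sr<g = <-≤-trans (s<g₀ r r<t) (≤-trans g₀≤g₁ g₁≤g)
                z , z∈A , r⊏z , z<s , z⋢y = s-spec r r∈A y y∈A (inj₁ (<-≤-trans sr<g g≤y)) r⊏y
            in z , record { r = r ; r∈A = r∈A ; δ≤r = δ≤r ; r⊏y = r⊏y ; z∈A = z∈A
                           ; r⊏z = r⊏z ; z<g = <.trans z<s sr<g ; z⋢y = z⋢y }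
          where
          strict : ∀ {r y} → r < y → r ⊏ y ⊎ r ≡ y → r ⊏ y
          strict _ (inj₁ p) = p
          strict r<y (inj₂ refl) = ⊥-elim (<-irrefl r<y)

        -- Forks off the branch below a single y, at heights f ξ increasing
        -- fast enough, form an antichain.
        absurd : ⊥
        absurd = no-antichain z (λ ξ ξ<k → Fork.z∈A (z-fork ξ ξ<k))
          (λ ξ η ξ<η η<k → <.trans (z<r ξ<η η<k) (⊏⇒< (Fork.z∈A (z-fork η η<k)) (Fork.r⊏z (z-fork η η<k))))
          -- The branch below `z η` passes through `F.r`, which is higher than `z ξ`; so `z ξ` would
          -- lie below `F.r` and hence below `y`.
          λ ξ η ξ<η η<k zξ⊏zη →
            let module F = Fork (z-fork η η<k)
            in Fork.z⋢y (z-fork ξ (<.trans ξ<η η<k))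
                 (⊏-trans F.r∈A (extends-restrict zξ⊏zη F.r⊏z (z<r ξ<η η<k)) F.r⊏y)
          where
          G : Λ → Λ
          G δ = proj₁ (fork δ)

          heights : ∃[ f ] (∀ ξ → ξ < k → f ξ ∈ ↓ lam × (∀ η → η < ξ → G (f η) < f ξ))
          heights = recursion lam k (λ ν _ → bnd ν) (λ _ → ↓ lam) (λ _ _ → id)
            (λ _ _ → IsClub.unbounded (↓-isClub lam)) G (λ _ _ → ∈lam)

          f : Λ → Λ
          f = proj₁ heights

          top : ∃[ y ] (y ∈ A × (∀ ξ → ξ < k → G (f ξ) < y))
          top =
            let b , _ , Gf<b = bnd k (λ ξ → G (f ξ)) (λ _ _ → ∈lam)
                y , y∈A , b≤y = A-unb b ∈lam
            in y , y∈A , λ ξ ξ<k → <-≤-trans (Gf<b ξ ξ<k) b≤y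

          y : Λ
          y = proj₁ top

          forks : ∃[ z ] (∀ ξ → ξ < k → Fork (f ξ) (G (f ξ)) y (z ξ))
          forks = choose (λ ξ → Fork (f ξ) (G (f ξ)) y) y λ ξ ξ<k →
            proj₂ (fork (f ξ)) y (proj₁ (proj₂ top)) (inj₁ (proj₂ (proj₂ top) ξ ξ<k))

          z : Λ → Λ
          z = proj₁ forks

          z-fork : ∀ ξ → ξ < k → Fork (f ξ) (G (f ξ)) y (z ξ)
          z-fork = proj₂ forks

          z<r : ξ < η → (η<k : η < k) → z ξ < Fork.r (z-fork η η<k)
          z<r {ξ} {η} ξ<η η<k = <-≤-trans
            (<.trans (Fork.z<g (z-fork ξ (<.trans ξ<η η<k))) (proj₂ (proj₂ heights η η<k) ξ ξ<η))
            (Fork.δ≤r (z-fork η η<k))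

theorem2p11 : (∀ {a} → ExcludedMiddle a) →
    ∀ {ℓ} (W : WellOrder ℓ) → let open Ordinals W in
    ∀ (κ : Ordinal) → κ <⁺ lam →
    IsCardinal κ → IsUncountable κ →
    IsCardinal lam → IsUncountable lam → IsRegular lam →
    (∃[ 𝒞 ] (IsSquareSequence κ 𝒞 × IsFull 𝒞)) →
    ∀ (S : Subset) → IsStationary lam S → ¬ Refl< κ S
theorem2p11 em W .([ k ]) [ k ]<⊤⁺ card unc _ _ (_ , regular)
  (𝒞 , (coh , no-thread) , full) S S-stat refl< =
  let N , N∈ , cover = anchor-system card unc bnd coh S-stat refl<
  in Tree.Unthreaded.absurd card unc bnd coh
       -- `AccPoints 𝒞` lives one universe above `Subset`; `Small` brings it down.
       {A = λ α → Small (AccPoints 𝒞 α)}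
       (λ β β∈ → let α , a , β≤α = full β β∈ in α , small a , β≤α)
       N (λ α a → N∈ α (unsmall a))
       (λ b → let β , covers = cover b in β , λ α a → covers α (unsmall a))
       no-thread
  where
  open Ordinals W
  open Classical em W
  open Reflecting

  -- Regularity of λ, in the form ν < cf(λ) for every ν < λ.
  bnd : ∀ ν → Bounding lam ν
  bnd ν = bounding (regular [ ν ] [ ν ]<⊤⁺)
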